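{- Every up-set of $U(n)_{\wedge,\to}$ is definable by a $(\wedge,\to)$-formula: for every up-set $U\subseteq U(n)_{\wedge,\to}$ there is a $(\wedge,\to)$-formula $\varphi$ in $p_1,\dots,p_n$ such that $U=\{x\in U(n)_{\wedge,\to}: x\models\varphi\}$.
   Context: Models are posets with an order-preserving colouring $c:M\to\{0,1\}^n$ (componentwise order) and intuitionistic Kripke semantics ($x\models p_i$ iff $c(x)_i=1$). A $(\wedge,\to)$-formula is built from $p_1,\dots,p_n$ with $\wedge$ and $\to$ only. A point $x$ is separated if for some variable $q$, $x\not\models q$ but all $y>x$ satisfy $q$; $M^s$ denotes the separated points with restricted order and colouring. $U(n)$ is the $n$-universal model: the generated submodel of the canonical model of IPC on $p_1,\dots,p_n$ (prime filters of the free Heyting algebra ordered by inclusion, $c(x)_i=1$ iff $p_i\in x$) consisting of points with finite up-set. For every model of finite depth there is a unique p-morphism into $U(n)$; $U(n)_{\wedge,\to}$ denotes the image of the unique p-morphism $U(n)^s\to U(n)$; it is a finite generated submodel (up-set) of $U(n)$. -}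

module Defs where

open import Axiom.ExcludedMiddle using (ExcludedMiddle)
open import Data.Bool.Base as Bool using (Bool; true; false; T)
open import Data.Bool.Properties as Bool using ()
open import Data.Empty using (⊥; ⊥-elim)
open import Data.Fin.Base using (Fin)
open import Data.List.Base as List using (List; []; _∷_)
open import Data.List.Relation.Unary.Any using (Any; here; there)
import Data.List.Membership.Setoid as Membership
open import Data.Nat.Base using (ℕ)
open import Data.Product using (Σ; ∃; ∃-syntax; _×_; _,_; proj₁; proj₂)
open import Data.Sum.Base as Sum using (_⊎_; inj₁; inj₂)
open import Data.Unit.Base using (⊤; tt)
open import Data.Vec.Functional using (Vector)
open import Data.Vec.Functional.Relation.Binary.Pointwise using (Pointwise)
open import Function.Base using (_∘_)
open import Function.Bundles using (_⇔_; mk⇔; module Equivalence)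
open import Level using (0ℓ)
open import Relation.Binary.Bundles using (Poset)
import Relation.Binary.Construct.On as On
import Relation.Binary.Construct.NonStrictToStrict as ToStrict
open import Relation.Binary.Lattice.Bundles using (HeytingAlgebra)
open import Relation.Binary.PropositionalEquality using (_≡_; refl; sym; trans)
open import Relation.Nullary using (¬_; Dec; yes; no)
open import Relation.Nullary.Decidable using (isYes; toWitness; fromWitness)
open import Relation.Unary using (Pred)

private
  variable
    n : ℕ

infixr 7 _∧ᶠ_
infixr 6 _∨ᶠ_
infixr 5 _⇒ᶠ_

data Formula (n : ℕ) : Set where
  var            : Fin n → Formula n
  ⊤ᶠ ⊥ᶠ          : Formula n
  _∧ᶠ_ _∨ᶠ_ _⇒ᶠ_ : Formula n → Formula n → Formula n

data IsConjImp {n : ℕ} : Formula n → Set where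
  var  : ∀ i → IsConjImp (var i)
  _∧ᶠ_ : ∀ {φ ψ} → IsConjImp φ → IsConjImp ψ → IsConjImp (φ ∧ᶠ ψ)
  _⇒ᶠ_ : ∀ {φ ψ} → IsConjImp φ → IsConjImp ψ → IsConjImp (φ ⇒ᶠ ψ)

-- The free Heyting algebra on n generators: Heyting terms under the least
-- preorder satisfying the Heyting algebra laws (equivalently, φ ⊢ ψ is
-- derivability in IPC), with mutual ⊢ as equality.

infix 4 _⊢_

data _⊢_ {n : ℕ} : Formula n → Formula n → Set where
  ⊢-refl   : ∀ {φ} → φ ⊢ φ
  ⊢-trans  : ∀ {φ ψ χ} → φ ⊢ ψ → ψ ⊢ χ → φ ⊢ χ
  ⊤-max    : ∀ {φ} → φ ⊢ ⊤ᶠ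
  ⊥-min    : ∀ {φ} → ⊥ᶠ ⊢ φ
  ∧-projˡ  : ∀ {φ ψ} → φ ∧ᶠ ψ ⊢ φ
  ∧-projʳ  : ∀ {φ ψ} → φ ∧ᶠ ψ ⊢ ψ
  ∧-pair   : ∀ {φ ψ χ} → χ ⊢ φ → χ ⊢ ψ → χ ⊢ φ ∧ᶠ ψ
  ∨-injˡ   : ∀ {φ ψ} → φ ⊢ φ ∨ᶠ ψ
  ∨-injʳ   : ∀ {φ ψ} → ψ ⊢ φ ∨ᶠ ψ
  ∨-case   : ∀ {φ ψ χ} → φ ⊢ χ → ψ ⊢ χ → φ ∨ᶠ ψ ⊢ χ
  ⇒-curry  : ∀ {φ ψ χ} → χ ∧ᶠ φ ⊢ ψ → χ ⊢ φ ⇒ᶠ ψ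
  ⇒-uncurry : ∀ {φ ψ χ} → χ ⊢ φ ⇒ᶠ ψ → χ ∧ᶠ φ ⊢ ψ

FreeHeyting : ℕ → HeytingAlgebra 0ℓ 0ℓ 0ℓ
FreeHeyting n = record
  { Carrier = Formula n
  ; _≈_ = λ φ ψ → φ ⊢ ψ × ψ ⊢ φ
  ; _≤_ = _⊢_
  ; _∨_ = _∨ᶠ_
  ; _∧_ = _∧ᶠ_
  ; _⇨_ = _⇒ᶠ_
  ; ⊤ = ⊤ᶠ
  ; ⊥ = ⊥ᶠ
  ; isHeytingAlgebra = record
    { isBoundedLattice = record
      { isLattice = record
        { isPartialOrder = record
          { isPreorder = record
            { isEquivalence = record
              { refl = ⊢-refl , ⊢-refl
              ; sym = λ (p , q) → q , p
              ; trans = λ (p , q) (p′ , q′) → ⊢-trans p p′ , ⊢-trans q′ q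
              }
            ; reflexive = proj₁
            ; trans = ⊢-trans
            }
          ; antisym = _,_
          }
        ; supremum = λ _ _ → ∨-injˡ , ∨-injʳ , λ _ → ∨-case
        ; infimum = λ _ _ → ∧-projˡ , ∧-projʳ , λ _ → ∧-pair
        }
      ; maximum = λ _ → ⊤-max
      ; minimum = λ _ → ⊥-min
      }
    ; exponential = λ _ _ _ → ⇒-curry , ⇒-uncurry
    }
  }

-- Subsets of the algebra are given by their characteristic functions, which
-- under excluded middle are all subsets.

record PrimeFilter (H : HeytingAlgebra 0ℓ 0ℓ 0ℓ) : Set where
  open HeytingAlgebra H using (Carrier; _≤_; _∧_; _∨_) renaming (⊤ to 1H; ⊥ to 0H)
  field
    member   : Carrier → Bool
    upward   : ∀ {a b} → a ≤ b → T (member a) → T (member b)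
    ⊤-member : T (member 1H)
    ∧-member : ∀ {a b} → T (member a) → T (member b) → T (member (a ∧ b))
    proper   : ¬ T (member 0H)
    prime    : ∀ {a b} → T (member (a ∨ b)) → T (member a) ⊎ T (member b)

open PrimeFilter public

private
  T⇒≤ : ∀ {a b} → (T a → T b) → a Bool.≤ b
  T⇒≤ {false}         _ = Bool.≤-minimum _
  T⇒≤ {true}  {true}  _ = Bool.b≤b
  T⇒≤ {true}  {false} h = ⊥-elim (h tt)

  ≤⇒T : ∀ {a b} → a Bool.≤ b → T a → T b
  ≤⇒T Bool.b≤b t = t

PrimeFilters : HeytingAlgebra 0ℓ 0ℓ 0ℓ → Poset 0ℓ 0ℓ 0ℓ
PrimeFilters H = record
  { Carrier = PrimeFilter H
  ; _≈_ = λ F G → ∀ a → member F a ≡ member G a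
  ; _≤_ = λ F G → ∀ a → T (member F a) → T (member G a)
  ; isPartialOrder = record
    { isPreorder = record
      { isEquivalence = record
        { refl = λ _ → refl
        ; sym = λ p a → sym (p a)
        ; trans = λ p q a → trans (p a) (q a)
        }
      ; reflexive = λ p a → ≤⇒T (Bool.≤-reflexive (p a))
      ; trans = λ p q a → q a ∘ p a
      }
    ; antisym = λ p q a → Bool.≤-antisym (T⇒≤ (p a)) (T⇒≤ (q a))
    }
  }

record Model (n : ℕ) : Set₁ where
  field
    poset : Poset 0ℓ 0ℓ 0ℓ

  open Poset poset public hiding (refl; trans)
  open ToStrict _≈_ _≤_ public using (_<_)

  field
    colour      : Carrier → Vector Bool n
    colour-mono : ∀ {x y} → x ≤ y → Pointwise Bool._≤_ (colour x) (colour y)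

infix 4 _∙_⊨_

_∙_⊨_ : (M : Model n) → Model.Carrier M → Formula n → Set
M ∙ x ⊨ var i    = T (Model.colour M x i)
M ∙ x ⊨ ⊤ᶠ       = ⊤
M ∙ x ⊨ ⊥ᶠ       = ⊥
M ∙ x ⊨ (φ ∧ᶠ ψ) = M ∙ x ⊨ φ × M ∙ x ⊨ ψ
M ∙ x ⊨ (φ ∨ᶠ ψ) = M ∙ x ⊨ φ ⊎ M ∙ x ⊨ ψ
M ∙ x ⊨ (φ ⇒ᶠ ψ) = ∀ y → Model._≤_ M x y → M ∙ y ⊨ φ → M ∙ y ⊨ ψ

IsUpSet : (M : Model n) → Pred (Model.Carrier M) 0ℓ → Set
IsUpSet M V = ∀ {x y} → x ≤ y → V x → V y
  where open Model M

_↾_ : (M : Model n) → Pred (Model.Carrier M) 0ℓ → Model n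
M ↾ P = record
  { poset = On.poset (Model.poset M) (proj₁ {B = P})
  ; colour = Model.colour M ∘ proj₁
  ; colour-mono = Model.colour-mono M
  }

record PMorphism (M N : Model n) : Set where
  private
    module M = Model M
    module N = Model N
  field
    map        : M.Carrier → N.Carrier
    mono       : ∀ {x y} → x M.≤ y → map x N.≤ map y
    colour-map : ∀ x i → N.colour (map x) i ≡ M.colour x i
    back       : ∀ {x y} → map x N.≤ y → ∃[ z ] x M.≤ z × map z N.≈ y

  Image : Pred N.Carrier 0ℓ
  Image y = ∃[ x ] map x N.≈ y

Separated : (M : Model n) → Pred (Model.Carrier M) 0ℓ
Separated {n} M x =
  ∃[ q ] ¬ (M ∙ x ⊨ var q) × (∀ y → Model._<_ M x y → M ∙ y ⊨ var q)

infix 10 _ˢ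

_ˢ : Model n → Model n
M ˢ = M ↾ Separated M

UpFinite : (M : Model n) → Pred (Model.Carrier M) 0ℓ
UpFinite M x = ∃[ ys ] ∀ y → (y ∈ ys) ⇔ (x ≤ y)
  where
  open Model M
  open Membership Eq.setoid using (_∈_)

Canonical : (n : ℕ) → Model n
Canonical n = record
  { poset = PrimeFilters (FreeHeyting n)
  ; colour = λ F i → member F (var i)
  ; colour-mono = λ F≤G i → T⇒≤ (F≤G (var i))
  }

-- The n-universal model.
U : (n : ℕ) → Model n
U n = Canonical n ↾ UpFinite (Canonical n)

-- U(n)_{∧,→}, for f the p-morphism U(n)ˢ → U(n).  One exists (U-pMorphism),
-- and any two agree, since a p-morphism into U(n) sends x to the theory of x.
U∧→ : (n : ℕ) → PMorphism (U n ˢ) (U n) → Model n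
U∧→ n f = U n ↾ PMorphism.Image f

-- If every ↑x in M is finite, then sending a point to its theory is a
-- p-morphism M → U(n).  This applies to U(n)ˢ.

module _ (M : Model n) where
  open Model M
  open Poset poset using () renaming (refl to ≤-refl; trans to ≤-trans)

  ⊨-mono : ∀ φ {x y} → x ≤ y → M ∙ x ⊨ φ → M ∙ y ⊨ φ
  ⊨-mono (var i)  x≤y p = ≤⇒T (colour-mono x≤y i) p
  ⊨-mono ⊤ᶠ       x≤y p = tt
  ⊨-mono (φ ∧ᶠ ψ) x≤y (p , q) = ⊨-mono φ x≤y p , ⊨-mono ψ x≤y q
  ⊨-mono (φ ∨ᶠ ψ) x≤y = Sum.map (⊨-mono φ x≤y) (⊨-mono ψ x≤y)
  ⊨-mono (φ ⇒ᶠ ψ) x≤y p z y≤z = p z (≤-trans x≤y y≤z)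

  ⊨-sound : ∀ {φ ψ} → φ ⊢ ψ → ∀ x → M ∙ x ⊨ φ → M ∙ x ⊨ ψ
  ⊨-sound ⊢-refl        x p = p
  ⊨-sound (⊢-trans d e) x p = ⊨-sound e x (⊨-sound d x p)
  ⊨-sound ⊤-max         x p = tt
  ⊨-sound ∧-projˡ       x p = proj₁ p
  ⊨-sound ∧-projʳ       x p = proj₂ p
  ⊨-sound (∧-pair d e)  x p = ⊨-sound d x p , ⊨-sound e x p
  ⊨-sound ∨-injˡ        x p = inj₁ p
  ⊨-sound ∨-injʳ        x p = inj₂ p
  ⊨-sound (∨-case d e)  x   = Sum.[ ⊨-sound d x , ⊨-sound e x ]
  ⊨-sound (⇒-curry {χ = χ} d) x p y x≤y q = ⊨-sound d y (⊨-mono χ x≤y p , q)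
  ⊨-sound (⇒-uncurry d) x (p , q) = ⊨-sound d x p x ≤-refl q

module Theory (em : ExcludedMiddle 0ℓ) (M : Model n) where
  open Model M
  open Poset poset using () renaming (refl to ≤-refl; trans to ≤-trans)
  open Membership Eq.setoid using (_∈_)
  private
    module C = Model (Canonical n)
    module C∈ = Membership C.Eq.setoid

  th : Carrier → C.Carrier
  th x = record
    { member = λ φ → isYes (em {M ∙ x ⊨ φ})
    ; upward = λ d p → fromWitness (⊨-sound M d x (toWitness p))
    ; ⊤-member = fromWitness tt
    ; ∧-member = λ p q → fromWitness (toWitness p , toWitness q)
    ; proper = toWitness
    ; prime = Sum.map fromWitness fromWitness ∘ toWitness
    }

  th-mono : ∀ {x y} → x ≤ y → th x C.≤ th y
  th-mono x≤y φ p = fromWitness (⊨-mono M φ x≤y (toWitness p))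

  private
    Separates : C.Carrier → Carrier → Set
    Separates F y =
      (∃[ β ] T (member F β) × ¬ (M ∙ y ⊨ β)) ⊎ (∃[ α ] ¬ T (member F α) × M ∙ y ⊨ α)

    compare : ∀ F y → th y C.≈ F ⊎ Separates F y
    compare F y with em {Separates F y}
    ... | yes s = inj₂ s
    ... | no ¬s = inj₁ (C.antisym {th y} {F} th≤F F≤th)
      where
      th≤F : th y C.≤ F
      th≤F φ p with em {T (member F φ)}
      ... | yes q = q
      ... | no ¬q = ⊥-elim (¬s (inj₂ (φ , ¬q , toWitness p)))
      F≤th : F C.≤ th y
      F≤th φ q with em {M ∙ y ⊨ φ}
      ... | yes p = _
      ... | no ¬p = ¬s (inj₁ (φ , q , ¬p))

    separate : ∀ F (ys : List Carrier) →
      (∃[ y ] y ∈ ys × th y C.≈ F) ⊎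
      (∃[ β ] ∃[ α ] T (member F β) × ¬ T (member F α) ×
        (∀ {y} → y ∈ ys → M ∙ y ⊨ β → M ∙ y ⊨ α))
    separate F [] = inj₂ (⊤ᶠ , ⊥ᶠ , ⊤-member F , proper F , λ ())
    separate F (z ∷ zs) with compare F z | separate F zs
    ... | inj₁ e | _ = inj₁ (z , here Eq.refl , e)
    ... | inj₂ _ | inj₁ (y , y∈ , e) = inj₁ (y , there y∈ , e)
    ... | inj₂ (inj₁ (β′ , β′∈ , ¬p)) | inj₂ (β , α , β∈ , α∉ , h) =
      inj₂ (β′ ∧ᶠ β , α , ∧-member F β′∈ β∈ , α∉ , λ
        { (here y≈z) (q , _) → ⊥-elim (¬p (⊨-mono M β′ (reflexive y≈z) q))
        ; (there y∈) (_ , q) → h y∈ q })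
    ... | inj₂ (inj₂ (α′ , α′∉ , p)) | inj₂ (β , α , β∈ , α∉ , h) =
      inj₂ (β , α′ ∨ᶠ α , β∈ , Sum.[ α′∉ , α∉ ] ∘ prime F , λ
        { (here y≈z) _ → inj₁ (⊨-mono M α′ (reflexive (Eq.sym y≈z)) p)
        ; (there y∈) q → inj₂ (h y∈ q) })

  th-back : ∀ {x F} → UpFinite M x → th x C.≤ F → ∃[ z ] x ≤ z × th z C.≈ F
  th-back {x} {F} (ys , enum) x≤F with separate F ys
  ... | inj₁ (z , z∈ , e) = z , Equivalence.to (enum z) z∈ , e
  ... | inj₂ (β , α , β∈ , α∉ , h) =
    ⊥-elim (α∉ (upward F (⇒-uncurry {φ = β} {ψ = α} ⊢-refl) (∧-member F imp∈ β∈)))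
    where
    imp∈ : T (member F (β ⇒ᶠ α))
    imp∈ = x≤F (β ⇒ᶠ α)
      (fromWitness (λ y x≤y → h (Equivalence.from (enum y) x≤y)))

  private
    ∈-map⁺ : ∀ {z F} ys → z ∈ ys → th z C.≈ F → F C∈.∈ List.map th ys
    ∈-map⁺ {z} {F} (y ∷ ys) (here z≈y) e =
      here (C.Eq.trans {F} {th z} {th y} (C.Eq.sym {th z} {F} e)
        (C.antisym {th z} {th y} (th-mono (reflexive z≈y)) (th-mono (reflexive (Eq.sym z≈y)))))
    ∈-map⁺ {F = F} (y ∷ ys) (there z∈) e = there (∈-map⁺ {F = F} ys z∈ e)

    ∈-map⁻ : ∀ {F} ys → F C∈.∈ List.map th ys → ∃[ z ] z ∈ ys × F C.≈ th z
    ∈-map⁻ (y ∷ ys) (here e) = y , here Eq.refl , e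
    ∈-map⁻ {F} (y ∷ ys) (there F∈) with ∈-map⁻ {F} ys F∈
    ... | z , z∈ , e = z , there z∈ , e

  th-upFinite : ∀ {x} → UpFinite M x → UpFinite (Canonical n) (th x)
  th-upFinite {x} fin@(ys , enum) = List.map th ys , λ F → mk⇔ (to F) (from F)
    where
    to : ∀ F → F C∈.∈ List.map th ys → th x C.≤ F
    to F F∈ with ∈-map⁻ {F} ys F∈
    ... | z , z∈ , e =
      C.≤-respʳ-≈ {th x} {th z} {F} (C.Eq.sym {F} {th z} e)
        (th-mono (Equivalence.to (enum z) z∈))
    from : ∀ F → th x C.≤ F → F C∈.∈ List.map th ys
    from F x≤F with th-back {F = F} fin x≤F
    ... | z , x≤z , e = ∈-map⁺ {F = F} ys (Equivalence.from (enum z) x≤z) e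

  thPMorphism : (∀ x → UpFinite M x) → PMorphism M (U n)
  thPMorphism fin = record
    { map = λ x → th x , th-upFinite (fin x)
    ; mono = th-mono
    ; colour-map = λ x i → Bool.≤-antisym (T⇒≤ toWitness) (T⇒≤ fromWitness)
    ; back = λ {x} {(F , _)} → th-back {F = F} (fin x)
    }

upFinite-↾ : ExcludedMiddle 0ℓ → (M : Model n) (P : Pred (Model.Carrier M) 0ℓ) →
             ∀ x → UpFinite M (proj₁ x) → UpFinite (M ↾ P) x
upFinite-↾ em M P x (ys , enum) = pick ys , λ z → mk⇔
  (Equivalence.to (enum (proj₁ z)) ∘ ∈-pick⁻ {z} ys)
  (∈-pick⁺ {z} ys ∘ Equivalence.from (enum (proj₁ z)))
  where
  open Model M
  open Membership Eq.setoid using (_∈_)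
  module R∈ = Membership (Model.Eq.setoid (M ↾ P))

  choose : ∀ y → Dec (Σ (∃ P) λ z → proj₁ z ≈ y)
  choose y = em

  pick : List Carrier → List (∃ P)
  pick [] = []
  pick (y ∷ ys) with choose y
  ... | yes (z , _) = z ∷ pick ys
  ... | no _        = pick ys

  ∈-pick⁺ : ∀ {z} ys → proj₁ z ∈ ys → z R∈.∈ pick ys
  ∈-pick⁺ {z} (y ∷ ys) z∈ with choose y | z∈
  ... | yes (w , w≈y) | here z≈y  = here (Eq.trans z≈y (Eq.sym w≈y))
  ... | yes _         | there z∈′ = there (∈-pick⁺ {z} ys z∈′)
  ... | no ¬w         | here z≈y  = ⊥-elim (¬w (z , z≈y))
  ... | no _          | there z∈′ = ∈-pick⁺ {z} ys z∈′

  ∈-pick⁻ : ∀ {z} ys → z R∈.∈ pick ys → proj₁ z ∈ ys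
  ∈-pick⁻ (y ∷ ys) z∈ with choose y
  ∈-pick⁻ (y ∷ ys) (here z≈w) | yes (w , w≈y) = here (Eq.trans z≈w w≈y)
  ∈-pick⁻ {z} (y ∷ ys) (there z∈) | yes _ = there (∈-pick⁻ {z} ys z∈)
  ∈-pick⁻ {z} (y ∷ ys) z∈         | no _  = there (∈-pick⁻ {z} ys z∈)

U-pMorphism : ExcludedMiddle 0ℓ → (n : ℕ) → PMorphism (U n ˢ) (U n)
U-pMorphism em n = Theory.thPMorphism em (U n ˢ) λ x →
  upFinite-↾ em (U n) (Separated (U n)) x
    (upFinite-↾ em (Canonical n) (UpFinite (Canonical n)) (proj₁ x)
      (proj₂ (proj₁ x)))

{-# OPTIONS --safe #-}

-- Every point of U(n)_{∧,→} is separated: if f s = x and x < y, the back condition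
-- yields t > s with f t = y, and s is separated.  In a model all of whose points
-- are separated the number of true variables strictly increases along <, and if w
-- is separated by q, then the (∧,→)-formula δ → q, where δ is the conjunction of
-- the θ ∈ Θ true at w and of θ → q for the θ ∈ Θ false at w, fails at exactly the
-- points below some z having the same Θ-theory as w.  Iterating Θ ↦ Θ ∪ {δ → q}
-- from the variables, n + 1 rounds determine every point up to ≈, because a point
-- of U(n) is determined by its colour and the points strictly above it.

module Submission where

open import Defs
open import Axiom.ExcludedMiddle using (ExcludedMiddle)
open import Data.Nat.Base using (ℕ; NonZero)
open import Data.Product using (∃-syntax; _×_)
open import Function.Bundles using (_⇔_)
open import Level using (0ℓ)
open import Relation.Unary using (Pred)

open import Data.Bool.Base using (T)
open import Data.Bool.Properties using (T-≡)
open import Data.Empty using (⊥-elim)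
open import Data.Fin.Base using (Fin; fromℕ<)
open import Data.Fin.Subset using (Subset; ∣_∣) renaming (_∈_ to _∈ˢ_)
open import Data.Fin.Subset.Properties using (∣p∣≤n; p⊆q⇒∣p∣≤∣q∣; p⊂q⇒∣p∣<∣q∣)
open import Data.List.Base using (List; []; _∷_; [_]; _++_; map; concatMap; filter; foldl; foldr;
  allFin; cartesianProductWith)
open import Data.List.Membership.Propositional using (_∈_; lose)
open import Data.List.Membership.Propositional.Properties
  using (∈-map⁺; ∈-++⁺ˡ; ∈-++⁺ʳ; ∈-concatMap⁺; ∈-allFin; ∈-filter⁺; ∈-cartesianProductWith⁺)
import Data.List.Membership.Setoid.Properties as Membershipₚ
open import Data.List.Relation.Unary.All as All using (All; []; _∷_)
import Data.List.Relation.Unary.All.Properties as Allₚ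
open import Data.List.Relation.Unary.Any using (here; there)
open import Data.Nat.Base using (zero; suc; _+_; _<_; _≤_; s≤s; _⊔_; _≤′_;
  ≤′-reflexive; ≤′-step; >-nonZero⁻¹)
import Data.Nat.Properties as ℕₚ
open import Data.Product using (_,_; proj₁; proj₂)
open import Data.Sum.Base as Sum using (_⊎_; inj₁; inj₂)
open import Data.Vec.Base using (tabulate)
open import Data.Vec.Properties using (lookup∘tabulate; lookup⇒[]=; []=⇒lookup)
open import Function.Base using (_∘_; case_of_)
open import Function.Bundles using (mk⇔; module Equivalence)
open import Function.Construct.Symmetry using (⇔-sym)
open import Relation.Binary.Bundles using (Poset)
import Relation.Binary.Lattice.Properties.HeytingAlgebra as HeytingProperties
open import Relation.Binary.PropositionalEquality using (refl; sym; trans; subst)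
open import Relation.Nullary using (¬_; Dec; yes; no)
open import Relation.Nullary.Decidable using (isYes; toWitness; fromWitness; decidable-stable)

open Equivalence using (to; from)

private
  variable
    n : ℕ

-- Finite families of (∧,→)-formulas: diagrams, separators and their iteration.

⋀ : Fin n → List (Formula n) → Formula n
-- `var q ⇒ᶠ var q` stands in for ⊤, which is not a (∧,→)-formula; hence the variable argument.
⋀ q = foldr _∧ᶠ_ (var q ⇒ᶠ var q)

diagrams : Fin n → List (Formula n) → List (Formula n)
diagrams q []      = [ var q ⇒ᶠ var q ]
diagrams q (θ ∷ Θ) =
  map (θ ∧ᶠ_) (diagrams q Θ) ++ map ((θ ⇒ᶠ var q) ∧ᶠ_) (diagrams q Θ)

separators : List (Formula n) → List (Formula n)
separators Θ = concatMap (λ q → map (_⇒ᶠ var q) (diagrams q Θ)) (allFin _)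

stage : ℕ → List (Formula n)
stage zero    = map var (allFin _)
stage (suc k) = stage k ++ separators (stage k)

⋀-conjImp : ∀ (q : Fin n) {Θ} → All IsConjImp Θ → IsConjImp (⋀ q Θ)
⋀-conjImp q []       = var q ⇒ᶠ var q
⋀-conjImp q (c ∷ cs) = c ∧ᶠ ⋀-conjImp q cs

diagrams-conjImp : ∀ (q : Fin n) {Θ} → All IsConjImp Θ → All IsConjImp (diagrams q Θ)
diagrams-conjImp q []       = (var q ⇒ᶠ var q) ∷ []
diagrams-conjImp q (c ∷ cs) = Allₚ.++⁺
  (Allₚ.map⁺ (All.map (c ∧ᶠ_) (diagrams-conjImp q cs)))
  (Allₚ.map⁺ (All.map ((c ⇒ᶠ var q) ∧ᶠ_) (diagrams-conjImp q cs)))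

stage-conjImp : ∀ k → All IsConjImp (stage {n} k)
stage-conjImp zero    = Allₚ.map⁺ (All.universal var (allFin _))
stage-conjImp (suc k) = Allₚ.++⁺ (stage-conjImp k)
  (Allₚ.concat⁺ (Allₚ.map⁺ (All.universal
    (λ q → Allₚ.map⁺ (All.map (_⇒ᶠ var q) (diagrams-conjImp q (stage-conjImp k))))
    (allFin _))))

var∈stage : ∀ k (i : Fin n) → var i ∈ stage k
var∈stage zero    i = ∈-map⁺ var (∈-allFin i)
var∈stage (suc k) i = ∈-++⁺ˡ (var∈stage k i)

⋀⁺ : ∀ (M : Model n) {x} q {Θ} → All (M ∙ x ⊨_) Θ → M ∙ x ⊨ ⋀ q Θ
⋀⁺ M q []       = λ _ _ p → p
⋀⁺ M q (p ∷ ps) = p , ⋀⁺ M q ps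

⋀⁻ : ∀ (M : Model n) {x} q {Θ φ} → φ ∈ Θ → M ∙ x ⊨ ⋀ q Θ → M ∙ x ⊨ φ
⋀⁻ M q (here refl) (p , _) = p
⋀⁻ M q (there φ∈) (_ , ps) = ⋀⁻ M q φ∈ ps

-- Extensional models in which every point is separated.

Extensional : Model n → Set
Extensional M = ∀ x y →
  (∀ i → (M ∙ x ⊨ var i) ⇔ (M ∙ y ⊨ var i)) →
  -- The ≤ in the conclusions covers two cases: equal sets of points strictly above, and one point
  -- being the least strictly above the other.
  (∀ z → x <ᴹ z → y ≤ᴹ z) → (∀ z → y <ᴹ z → x ≤ᴹ z) → x ≈ y
  where open Model M renaming (_≤_ to _≤ᴹ_; _<_ to _<ᴹ_)

module SeparatedModel
  (em : ExcludedMiddle 0ℓ) (M : Model n)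
  (separated : ∀ x → Separated M x) (extensional : Extensional M) where

  open Model M renaming (_≤_ to _≤ᴹ_; _<_ to _<ᴹ_)
  open Poset poset using () renaming (refl to ≤ᴹ-refl; trans to ≤ᴹ-trans)

  private
    stable : ∀ {P : Set} → ¬ ¬ P → P
    stable = decidable-stable em

  Agree : List (Formula n) → Carrier → Carrier → Set
  Agree Θ x y = ∀ θ → θ ∈ Θ → (M ∙ x ⊨ θ) ⇔ (M ∙ y ⊨ θ)

  -- Since q holds strictly above x, every θ refuted at x satisfies x ⊨ θ → q;
  -- conversely a point refuting q and forcing θ → q refutes θ.
  diagram : ∀ {x q} → ¬ (M ∙ x ⊨ var q) → (∀ y → x <ᴹ y → M ∙ y ⊨ var q) → ∀ Θ →
    ∃[ δ ] δ ∈ diagrams q Θ × M ∙ x ⊨ δ ×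
      (∀ {y} → M ∙ y ⊨ δ → ¬ (M ∙ y ⊨ var q) → Agree Θ x y)
  diagram x⊭q >⊨q [] = _ , here refl , (λ _ _ p → p) , λ _ _ _ ()
  diagram {x} {q} x⊭q >⊨q (θ ∷ Θ) with diagram x⊭q >⊨q Θ | em {M ∙ x ⊨ θ}
  ... | δ , δ∈ , x⊨δ , agree | yes x⊨θ =
    θ ∧ᶠ δ , ∈-++⁺ˡ (∈-map⁺ _ δ∈) , (x⊨θ , x⊨δ) , λ
      { (y⊨θ , y⊨δ) y⊭q _ (here refl) → mk⇔ (λ _ → y⊨θ) (λ _ → x⊨θ)
      ; (y⊨θ , y⊨δ) y⊭q _ (there θ∈)  → agree y⊨δ y⊭q _ θ∈ }
  ... | δ , δ∈ , x⊨δ , agree | no x⊭θ =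
    (θ ⇒ᶠ var q) ∧ᶠ δ , ∈-++⁺ʳ _ (∈-map⁺ _ δ∈) , (x⊨θ⇒q , x⊨δ) , λ
      { (y⊨θ⇒q , y⊨δ) y⊭q _ (here refl) →
          mk⇔ (⊥-elim ∘ x⊭θ) (λ y⊨θ → ⊥-elim (y⊭q (y⊨θ⇒q _ ≤ᴹ-refl y⊨θ)))
      ; (y⊨θ⇒q , y⊨δ) y⊭q _ (there θ∈) → agree y⊨δ y⊭q _ θ∈ }
    where
    x⊨θ⇒q : M ∙ x ⊨ θ ⇒ᶠ var q
    x⊨θ⇒q y x≤y y⊨θ =
      >⊨q y (x≤y , λ x≈y → x⊭θ (⊨-mono M θ (reflexive (Eq.sym x≈y)) y⊨θ))

  separator : ∀ x Θ → ∃[ φ ] φ ∈ separators Θ × ¬ (M ∙ x ⊨ φ) ×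
    (∀ y → ¬ (M ∙ y ⊨ φ) → ∃[ z ] y ≤ᴹ z × Agree Θ x z)
  separator x Θ with separated x
  ... | q , x⊭q , >⊨q with diagram x⊭q >⊨q Θ
  ... | δ , δ∈ , x⊨δ , agree =
    δ ⇒ᶠ var q ,
    ∈-concatMap⁺ _ (lose (∈-allFin q) (∈-map⁺ _ δ∈)) ,
    (λ p → x⊭q (p x ≤ᴹ-refl x⊨δ)) ,
    -- Classically, refuting δ → q at y gives a z above y that forces δ and refutes q; there the
    -- diagram fixes the Θ-theory.
    λ y y⊭ → stable λ none → y⊭ λ z y≤z z⊨δ → stable λ z⊭q →
      none (z , y≤z , agree z⊨δ z⊭q)

  trueVars : Carrier → Subset n
  trueVars x = tabulate (colour x)

  ∈-trueVars⁺ : ∀ {x i} → M ∙ x ⊨ var i → i ∈ˢ trueVars x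
  ∈-trueVars⁺ {x} {i} p =
    lookup⇒[]= i _ (trans (lookup∘tabulate (colour x) i) (to T-≡ p))

  ∈-trueVars⁻ : ∀ {x i} → i ∈ˢ trueVars x → M ∙ x ⊨ var i
  ∈-trueVars⁻ {x} {i} i∈ =
    from T-≡ (trans (sym (lookup∘tabulate (colour x) i)) ([]=⇒lookup i∈))

  trueVars-strict : ∀ {x y} → x <ᴹ y → ∣ trueVars x ∣ < ∣ trueVars y ∣
  trueVars-strict {x} {y} x<y@(x≤y , _) with separated x
  ... | q , x⊭q , >⊨q = p⊂q⇒∣p∣<∣q∣
    ( (λ {i} → ∈-trueVars⁺ ∘ ⊨-mono M (var i) x≤y ∘ ∈-trueVars⁻)
    , q , ∈-trueVars⁺ (>⊨q y x<y) , x⊭q ∘ ∈-trueVars⁻)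

  -- Carries the bound in `agree⇒≈` from x over to y, so that `above` serves in both directions.
  agree⇒∣trueVars∣ : ∀ k {x y} → Agree (stage k) x y → ∣ trueVars x ∣ ≤ ∣ trueVars y ∣
  agree⇒∣trueVars∣ k agree =
    p⊆q⇒∣p∣≤∣q∣ (λ {i} → ∈-trueVars⁺ ∘ to (agree (var i) (var∈stage k i)) ∘ ∈-trueVars⁻)

  -- The bound says that x has fewer than k false variables.
  agree⇒≈ : ∀ k x y → n < ∣ trueVars x ∣ + k → Agree (stage k) x y → x ≈ y
  agree⇒≈ zero x y n<x _ = ⊥-elim
    (ℕₚ.<⇒≱ n<x (subst (_≤ n) (sym (ℕₚ.+-identityʳ _)) (∣p∣≤n (trueVars x))))
  agree⇒≈ (suc k) x y n<x agree =
    extensional x y (λ i → agree (var i) (var∈stage (suc k) i))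
      (above x y n<x agree)
      (above y x (ℕₚ.<-≤-trans n<x (ℕₚ.+-monoˡ-≤ (suc k) (agree⇒∣trueVars∣ (suc k) agree)))
        (λ θ θ∈ → ⇔-sym (agree θ θ∈)))
    where
    above : ∀ x y → n < ∣ trueVars x ∣ + suc k → Agree (stage (suc k)) x y →
      ∀ z → x <ᴹ z → y ≤ᴹ z
    -- The separator φ of z fails at z, hence at x, hence by agreement at y. So some z′ above y
    -- agrees with z on stage k. As z has more true variables than x, the bound survives the drop
    -- from k + 1 to k, and induction gives z ≈ z′.
    above x y n<x agree z x<z with separator z (stage k)
    ... | φ , φ∈ , z⊭φ , below
      with below y (z⊭φ ∘ ⊨-mono M φ (proj₁ x<z) ∘ from (agree φ (∈-++⁺ʳ (stage k) φ∈)))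
    ... | z′ , y≤z′ , agree′ =
      ≤ᴹ-trans y≤z′ (reflexive (Eq.sym (agree⇒≈ k z z′ n<z agree′)))
      where
      n<z : n < ∣ trueVars z ∣ + k
      n<z = ℕₚ.<-≤-trans (subst (n <_) (ℕₚ.+-suc _ k) n<x)
        (ℕₚ.+-monoˡ-≤ k (trueVars-strict x<z))

  -- The conjunction of all formulas of a late stage that hold throughout V works. If x is outside
  -- V, a separator of x is among them: it fails at v only if v lies below a point ≈ x, which for v
  -- in V would put x in V.
  definable : Fin n → (V : Pred Carrier 0ℓ) → IsUpSet M V →
    ∃[ φ ] IsConjImp φ × (∀ x → V x ⇔ (M ∙ x ⊨ φ))
  definable q V upset =
    ⋀ q Ψ , ⋀-conjImp q (Allₚ.filter⁺ valid? (stage-conjImp (suc (suc n)))) ,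
    λ x → mk⇔ (sound x) (complete x)
    where
    valid? : ∀ φ → Dec (∀ v → V v → M ∙ v ⊨ φ)
    valid? φ = em
    Ψ : List (Formula n)
    -- Stage n + 1 determines points up to ≈; the separators over it are added one stage later.
    Ψ = filter valid? (stage (suc (suc n)))
    sound : ∀ x → V x → M ∙ x ⊨ ⋀ q Ψ
    sound x x∈V = ⋀⁺ M q (All.map (λ valid → valid x x∈V)
      (Allₚ.all-filter valid? (stage (suc (suc n)))))
    complete : ∀ x → M ∙ x ⊨ ⋀ q Ψ → V x
    complete x x⊨Ψ with separator x (stage (suc n))
    ... | φ , φ∈ , x⊭φ , below = stable λ x∉V → x⊭φ (⋀⁻ M q
      (∈-filter⁺ valid? (∈-++⁺ʳ (stage (suc n)) φ∈) λ v v∈V → stable λ v⊭φ →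
        let (z , v≤z , agree) = below v v⊭φ
            x≈z = agree⇒≈ (suc n) x z (ℕₚ.m≤n+m (suc n) _) agree
        in x∉V (upset (≤ᴹ-trans v≤z (reflexive (Eq.sym x≈z))) v∈V))
      x⊨Ψ)

-- Up-sets, generated submodels and images of p-morphisms.

upFinite-upSet : ExcludedMiddle 0ℓ → (M : Model n) → IsUpSet M (UpFinite M)
upFinite-upSet em M {x} {y} x≤y (xs , enum) =
  filter above? xs , λ z → mk⇔
    (proj₂ ∘ Membershipₚ.∈-filter⁻ Eq.setoid above? resp {xs = xs})
    (λ y≤z → Membershipₚ.∈-filter⁺ Eq.setoid above? resp {xs = xs}
      (from (enum z) (≤ᴹ-trans x≤y y≤z)) y≤z)
  where
  open Model M renaming (_≤_ to _≤ᴹ_)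
  open Poset poset using () renaming (trans to ≤ᴹ-trans)
  above? : ∀ z → Dec (y ≤ᴹ z)
  above? z = em
  resp : ∀ {z z′} → z ≈ z′ → y ≤ᴹ z → y ≤ᴹ z′
  resp z≈z′ y≤z = ≤ᴹ-trans y≤z (reflexive z≈z′)

-- An up-set keeps every point above its members, so both conditions range over the same z as in
-- `M`.
extensional-↾ : ∀ (M : Model n) {P} → IsUpSet M P → Extensional M → Extensional (M ↾ P)
extensional-↾ M upset ext (x , x∈P) (y , y∈P) same x<⇒y≤ y<⇒x≤ = ext x y same
  (λ z x<z → x<⇒y≤ (z , upset (proj₁ x<z) x∈P) x<z)
  (λ z y<z → y<⇒x≤ (z , upset (proj₁ y<z) y∈P) y<z)

image-upSet : {M N : Model n} (f : PMorphism M N) → IsUpSet N (PMorphism.Image f)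
image-upSet {N = N} f x≤y (s , fs≈x)
  with PMorphism.back f (Poset.trans N.poset (N.reflexive fs≈x) x≤y)
  where module N = Model N
... | t , _ , ft≈y = t , ft≈y

image-separated : {M N : Model n} (f : PMorphism (M ˢ) N) →
  ∀ x → Separated (N ↾ PMorphism.Image f) x
image-separated {M = M} {N} f (x , s@(u , q , u⊭q , >⊨q) , fs≈x) =
  q ,
  u⊭q ∘ subst T (f.colour-map s q) ∘ ⊨-mono N (var q) (N.reflexive (N.Eq.sym fs≈x)) ,
  above
  where
  module M = Model M
  module N = Model N
  module f = PMorphism f
  above : ∀ y → Model._<_ (N ↾ f.Image) (x , s , fs≈x) y → N ∙ proj₁ y ⊨ var q
  above (y , _) (x≤y , x≉y) with f.back (Poset.trans N.poset (N.reflexive fs≈x) x≤y)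
  ... | t , s≤t , ft≈y = ⊨-mono N (var q) (N.reflexive ft≈y)
    (subst T (sym (f.colour-map t q)) (>⊨q (proj₁ t) (s≤t , s≉t)))
    where
    s≉t : ¬ (u M.≈ proj₁ t)
    -- A monotone map preserves ≈ by antisymmetry, so u ≈ t would force x ≈ y.
    s≉t u≈t = x≉y (N.Eq.trans (N.Eq.sym fs≈x) (N.Eq.trans
      (N.antisym (f.mono s≤t) (f.mono (M.reflexive (M.Eq.sym u≈t)))) ft≈y))

-- Exhausting the formulas by finite lists.

connectives : List (Formula n → Formula n → Formula n)
connectives = _∧ᶠ_ ∷ _∨ᶠ_ ∷ _⇒ᶠ_ ∷ []

-- The list at k collects the formulas of `depth` at most k, a finite batch for one step of the
-- Lindenbaum chain.
formulas : ℕ → List (Formula n)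
formulas zero    = []
formulas (suc k) = ⊤ᶠ ∷ ⊥ᶠ ∷ map var (allFin _) ++
  concatMap (λ _∘_ → cartesianProductWith _∘_ (formulas k) (formulas k)) connectives

depth : Formula n → ℕ
depth (var i)  = 1
depth ⊤ᶠ       = 1
depth ⊥ᶠ       = 1
depth (φ ∧ᶠ ψ) = suc (depth φ ⊔ depth ψ)
depth (φ ∨ᶠ ψ) = suc (depth φ ⊔ depth ψ)
depth (φ ⇒ᶠ ψ) = suc (depth φ ⊔ depth ψ)

∈-formulas-binary : ∀ {k} {_∘_ : Formula n → Formula n → Formula n} {φ ψ} →
  _∘_ ∈ connectives → φ ∈ formulas k → ψ ∈ formulas k → φ ∘ ψ ∈ formulas (suc k)
∈-formulas-binary {n} {k} {_∘_} ∘∈ φ∈ ψ∈ = there (there (∈-++⁺ʳ (map var (allFin n))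
  (∈-concatMap⁺ (λ _∘′_ → cartesianProductWith _∘′_ (formulas k) (formulas k))
    (lose ∘∈ (∈-cartesianProductWith⁺ _∘_ φ∈ ψ∈)))))

∈-formulas : ∀ {k} (φ : Formula n) → depth φ ≤ k → φ ∈ formulas k
∈-formulas (var i) (s≤s _) = there (there (∈-++⁺ˡ (∈-map⁺ var (∈-allFin i))))
∈-formulas ⊤ᶠ      (s≤s _) = here refl
∈-formulas ⊥ᶠ      (s≤s _) = there (here refl)
∈-formulas (φ ∧ᶠ ψ) (s≤s d) = ∈-formulas-binary (here refl)
  (∈-formulas φ (ℕₚ.m⊔n≤o⇒m≤o _ _ d)) (∈-formulas ψ (ℕₚ.m⊔n≤o⇒n≤o _ _ d))
∈-formulas (φ ∨ᶠ ψ) (s≤s d) = ∈-formulas-binary (there (here refl))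
  (∈-formulas φ (ℕₚ.m⊔n≤o⇒m≤o _ _ d)) (∈-formulas ψ (ℕₚ.m⊔n≤o⇒n≤o _ _ d))
∈-formulas (φ ⇒ᶠ ψ) (s≤s d) = ∈-formulas-binary (there (there (here refl)))
  (∈-formulas φ (ℕₚ.m⊔n≤o⇒m≤o _ _ d)) (∈-formulas ψ (ℕₚ.m⊔n≤o⇒n≤o _ _ d))

-- Prime filters that extend F, contain φ and omit ψ.

module Lindenbaum (em : ExcludedMiddle 0ℓ) (F : PrimeFilter (FreeHeyting n))
  {φ ψ : Formula n} (φ⇒ψ∉F : ¬ T (member F (φ ⇒ᶠ ψ))) where

  private
    module Hₚ = HeytingProperties (FreeHeyting n)

  ∈F : Formula n → Set
  ∈F χ = T (member F χ)

  -- A formula γ stands for the filter {χ : γ → χ ∈ F} it generates over F, which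
  -- excludes ψ iff γ is consistent; the prime filter is the union along a chain of
  -- such γ that decides every formula.
  Consistent : Formula n → Set
  Consistent γ = ¬ ∈F (γ ⇒ᶠ ψ)

  -- The second alternative says that adding χ to γ would bring ψ into the generated filter.
  Decides : Formula n → Formula n → Set
  Decides γ χ = γ ⊢ χ ⊎ ∈F (χ ⇒ᶠ γ ⇒ᶠ ψ)

  -- Keeps a decision valid along the rest of the chain, where γ only gets stronger.
  decides-anti : ∀ {γ γ′ χ} → γ′ ⊢ γ → Decides γ χ → Decides γ′ χ
  decides-anti γ′⊢γ = Sum.map (⊢-trans γ′⊢γ)
    (upward F (Hₚ.⇨ʳ-covariant (Hₚ.⇨ˡ-contravariant γ′⊢γ)))

  extend : Formula n → Formula n → Formula n
  extend γ χ with em {∈F (χ ⇒ᶠ γ ⇒ᶠ ψ)}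
  ... | yes _ = γ
  ... | no  _ = χ ∧ᶠ γ

  extend-⊢ : ∀ γ χ → extend γ χ ⊢ γ
  extend-⊢ γ χ with em {∈F (χ ⇒ᶠ γ ⇒ᶠ ψ)}
  ... | yes _ = ⊢-refl
  ... | no  _ = ∧-projʳ

  extend-consistent : ∀ γ χ → Consistent γ → Consistent (extend γ χ)
  extend-consistent γ χ con with em {∈F (χ ⇒ᶠ γ ⇒ᶠ ψ)}
  ... | yes _ = con
  ... | no χ⇒γ⇒ψ∉ = χ⇒γ⇒ψ∉ ∘ upward F (proj₁ Hₚ.⇨-curry)

  extend-decides : ∀ γ χ → Decides (extend γ χ) χ
  extend-decides γ χ with em {∈F (χ ⇒ᶠ γ ⇒ᶠ ψ)}
  ... | yes χ⇒γ⇒ψ∈ = inj₂ χ⇒γ⇒ψ∈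
  ... | no  _ = inj₁ ∧-projˡ

  extendAll-⊢ : ∀ χs γ → foldl extend γ χs ⊢ γ
  extendAll-⊢ []       γ = ⊢-refl
  extendAll-⊢ (χ ∷ χs) γ = ⊢-trans (extendAll-⊢ χs (extend γ χ)) (extend-⊢ γ χ)

  extendAll-consistent : ∀ χs γ → Consistent γ → Consistent (foldl extend γ χs)
  extendAll-consistent []       γ con = con
  extendAll-consistent (χ ∷ χs) γ con =
    extendAll-consistent χs (extend γ χ) (extend-consistent γ χ con)

  extendAll-decides : ∀ {χs χ} γ → χ ∈ χs → Decides (foldl extend γ χs) χ
  extendAll-decides {χ ∷ χs} γ (here refl) =
    decides-anti (extendAll-⊢ χs (extend γ χ)) (extend-decides γ χ)
  extendAll-decides γ (there χ∈) = extendAll-decides (extend γ _) χ∈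

  chain : ℕ → Formula n
  chain zero    = φ
  chain (suc k) = foldl extend (chain k) (formulas k)

  chain-consistent : ∀ k → Consistent (chain k)
  chain-consistent zero    = φ⇒ψ∉F
  chain-consistent (suc k) = extendAll-consistent (formulas k) (chain k) (chain-consistent k)

  chain-anti : ∀ {k l} → k ≤′ l → chain l ⊢ chain k
  chain-anti (≤′-reflexive refl) = ⊢-refl
  chain-anti (≤′-step {l} k≤l) = ⊢-trans (extendAll-⊢ (formulas l) (chain l)) (chain-anti k≤l)

  chain-decides : ∀ χ → ∃[ k ] Decides (chain k) χ
  -- `chain (suc k)` has treated `formulas k`, which contains χ at k = `depth χ`.
  chain-decides χ = suc (depth χ) , extendAll-decides (chain (depth χ)) (∈-formulas χ ℕₚ.≤-refl)

  Derivable : Formula n → Set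
  Derivable χ = ∃[ k ] ∈F (chain k ⇒ᶠ χ)

  ⊢⇒∈F : ∀ {γ χ} → γ ⊢ χ → ∈F (γ ⇒ᶠ χ)
  ⊢⇒∈F γ⊢χ = upward F (⇒-curry (⊢-trans ∧-projʳ γ⊢χ)) (⊤-member F)

  weaken : ∀ {k l χ} → k ≤ l → ∈F (chain k ⇒ᶠ χ) → ∈F (chain l ⇒ᶠ χ)
  weaken k≤l = upward F (Hₚ.⇨ˡ-contravariant (chain-anti (ℕₚ.≤⇒≤′ k≤l)))

  derivable-∧ : ∀ {a b} → Derivable a → Derivable b → Derivable (a ∧ᶠ b)
  derivable-∧ (k , p) (l , q) = k ⊔ l , upward F (Hₚ.⇨-distribˡ-∧-≥ _ _ _)
    (∧-member F (weaken (ℕₚ.m≤m⊔n k l) p) (weaken (ℕₚ.m≤n⊔m k l) q))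

  derivable-consistent : ¬ Derivable ψ
  derivable-consistent (k , p) = chain-consistent k p

  -- Otherwise both disjuncts are rejected: for a late γ in the chain, F contains a → γ → ψ and b →
  -- γ → ψ, hence (a ∨ b) → γ → ψ. With γ → a ∨ b this gives γ → ψ, against consistency.
  derivable-prime : ∀ {a b} → Derivable (a ∨ᶠ b) → Derivable a ⊎ Derivable b
  derivable-prime {a} {b} (k , p) with chain-decides a | chain-decides b
  ... | i , inj₁ q | _          = inj₁ (i , ⊢⇒∈F q)
  ... | _          | j , inj₁ r = inj₂ (j , ⊢⇒∈F r)
  ... | i , inj₂ q | j , inj₂ r = ⊥-elim (derivable-consistent (m , upward F modusPonens
    (∧-member F (weaken k≤m p) (upward F (Hₚ.⇨-distribˡ-∨-∧-≥ _ _ _)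
      (∧-member F (lower i≤m q) (lower j≤m r))))))
    where
    m : ℕ
    m = k ⊔ (i ⊔ j)
    k≤m : k ≤ m
    k≤m = ℕₚ.m≤m⊔n k (i ⊔ j)
    i≤m : i ≤ m
    i≤m = ℕₚ.≤-trans (ℕₚ.m≤m⊔n i j) (ℕₚ.m≤n⊔m k (i ⊔ j))
    j≤m : j ≤ m
    j≤m = ℕₚ.≤-trans (ℕₚ.m≤n⊔m i j) (ℕₚ.m≤n⊔m k (i ⊔ j))
    lower : ∀ {l χ} → l ≤ m → ∈F (χ ⇒ᶠ chain l ⇒ᶠ ψ) → ∈F (χ ⇒ᶠ chain m ⇒ᶠ ψ)
    lower l≤m = upward F
      (Hₚ.⇨ʳ-covariant (Hₚ.⇨ˡ-contravariant (chain-anti (ℕₚ.≤⇒≤′ l≤m))))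
    modusPonens : ∀ {γ χ} → (γ ⇒ᶠ χ) ∧ᶠ (χ ⇒ᶠ γ ⇒ᶠ ψ) ⊢ γ ⇒ᶠ ψ
    modusPonens = ⇒-curry (⊢-trans
      (∧-pair
        (⊢-trans (∧-pair (⊢-trans ∧-projˡ ∧-projʳ)
          (⊢-trans (∧-pair (⊢-trans ∧-projˡ ∧-projˡ) ∧-projʳ) Hₚ.⇨-eval)) Hₚ.⇨-eval)
        ∧-projʳ)
      Hₚ.⇨-eval)

  extension : PrimeFilter (FreeHeyting n)
  extension = record
    { member   = λ χ → isYes (em {Derivable χ})
    ; upward   = λ a⊢b p → let (k , q) = toWitness p in
        fromWitness (k , upward F (Hₚ.⇨ʳ-covariant a⊢b) q)
    ; ⊤-member = fromWitness (0 , ⊢⇒∈F ⊤-max)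
    ; ∧-member = λ p q → fromWitness (derivable-∧ (toWitness p) (toWitness q))
    ; proper   = λ p → let (k , q) = toWitness p in
        derivable-consistent (k , upward F (Hₚ.⇨ʳ-covariant ⊥-min) q)
    ; prime    = Sum.map fromWitness fromWitness ∘ derivable-prime ∘ toWitness
    }

  F≤extension : ∀ χ → ∈F χ → T (member extension χ)
  F≤extension χ χ∈ = fromWitness (0 , upward F Hₚ.y≤x⇨y χ∈)

  φ∈extension : T (member extension φ)
  φ∈extension = fromWitness (0 , ⊢⇒∈F ⊢-refl)

  ψ∉extension : ¬ T (member extension ψ)
  ψ∉extension = derivable-consistent ∘ toWitness

-- Extensionality of the canonical model.

canonical-extensional : ExcludedMiddle 0ℓ → Extensional (Canonical n)
canonical-extensional {n} em F G sameVars F<⇒G≤ G<⇒F≤ =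
  C.antisym {F} {G} (λ φ → to (same φ)) (λ φ → from (same φ))
  where
  module C = Model (Canonical n)
  ⇒-transfer : ∀ F G {φ ψ} → (∀ H → G C.< H → F C.≤ H) →
    (T (member F φ) ⇔ T (member G φ)) → (T (member F ψ) ⇔ T (member G ψ)) →
    T (member F (φ ⇒ᶠ ψ)) → T (member G (φ ⇒ᶠ ψ))
  ⇒-transfer F G {φ} {ψ} G<⇒F≤ sameφ sameψ φ⇒ψ∈F =
    decidable-stable em λ φ⇒ψ∉G → let
      module L = Lindenbaum em G φ⇒ψ∉G
      H = L.extension
    -- If H ≈ G, then φ is in G and so in F, whence ψ is in F and so in G. If H is strictly above G,
    -- then F ≤ H, so H contains φ → ψ and φ. Either way ψ is in H.
    in L.ψ∉extension (case em {G C.≈ H} of λ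
      { (yes G≈H) → subst T (G≈H ψ) (to sameψ (upward F (⇒-uncurry ⊢-refl)
          (∧-member F φ⇒ψ∈F (from sameφ (subst T (sym (G≈H φ)) L.φ∈extension)))))
      ; (no G≉H) → upward H (⇒-uncurry ⊢-refl)
          (∧-member H (G<⇒F≤ H (L.F≤extension , G≉H) (φ ⇒ᶠ ψ) φ⇒ψ∈F) L.φ∈extension) })

  -- Induction on φ; only implication uses the points strictly above F and G.
  same : ∀ φ → T (member F φ) ⇔ T (member G φ)
  same (var i)  = sameVars i
  same ⊤ᶠ       = mk⇔ (λ _ → ⊤-member G) (λ _ → ⊤-member F)
  same ⊥ᶠ       = mk⇔ (⊥-elim ∘ proper F) (⊥-elim ∘ proper G)
  same (φ ∧ᶠ ψ) = mk⇔
    (λ p → ∧-member G (to (same φ) (upward F ∧-projˡ p)) (to (same ψ) (upward F ∧-projʳ p)))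
    (λ p → ∧-member F (from (same φ) (upward G ∧-projˡ p)) (from (same ψ) (upward G ∧-projʳ p)))
  same (φ ∨ᶠ ψ) = mk⇔
    (Sum.[ upward G ∨-injˡ ∘ to (same φ) , upward G ∨-injʳ ∘ to (same ψ) ] ∘ prime F)
    (Sum.[ upward F ∨-injˡ ∘ from (same φ) , upward F ∨-injʳ ∘ from (same ψ) ] ∘ prime G)
  same (φ ⇒ᶠ ψ) = mk⇔
    (⇒-transfer F G G<⇒F≤ (same φ) (same ψ))
    (⇒-transfer G F F<⇒G≤ (⇔-sym (same φ)) (⇔-sym (same ψ)))

theorem3p15 :
    ExcludedMiddle 0ℓ →
    (n : ℕ) .{{_ : NonZero n}} →
    (f : PMorphism (U n ˢ) (U n)) →
    (V : Pred (Model.Carrier (U∧→ n f)) 0ℓ) → IsUpSet (U∧→ n f) V →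
    ∃[ φ ] IsConjImp φ × (∀ x → V x ⇔ (U∧→ n f ∙ x ⊨ φ))
theorem3p15 em n f =
  SeparatedModel.definable em (U∧→ n f)
    (image-separated f)
    (extensional-↾ (U n) (λ {x} {y} → image-upSet f {x} {y})
      (extensional-↾ (Canonical n) (λ {x} {y} → upFinite-upSet em (Canonical n) {x} {y})
        (canonical-extensional em)))
    -- n ≠ 0 provides the variable with which `⋀` writes ⊤.
    (fromℕ< (>-nonZero⁻¹ n))
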